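{- Let $G$ be a connected graph and let $\varphi$, $\theta$ be the relations on $E(G)$ defined by: $\{u,v\}\mathrel{\varphi}\{x,y\}$ iff $d(u,x)=d(v,y)$ and $d(u,y)=d(v,x)$; and $\{u,v\}\mathrel{\theta}\{x,y\}$ iff $d(u,x)+d(v,y)\neq d(u,y)+d(v,x)$. (a) If $G$ is a partial cube, then $\varphi$ coincides with $\theta$, is an equivalence relation on $E(G)$, and its classes are exactly the Djoković cuts, i.e. the coordinate classes of any isometric hypercube embedding of $G$. (b) Conversely, if $G$ is bipartite, $\varphi$ is an equivalence relation, and every $\varphi$-class is an edge cut whose two sides are convex subgraphs of $G$, then $G$ is a partial cube and the $\varphi$-classes are its $\theta$-classes.
   Context: Graphs are finite, simple, connected and undirected; $d=d_G$ is the shortest-path distance. The hypercube $Q_k$ has vertex set $\mathbb{Z}_2^k$ with two vertices adjacent iff they differ in exactly one coordinate. A partial cube is a graph admitting an isometric (distance-preserving) embedding into some $Q_k$. Given an isometric embedding of $G$ into a hypercube, the coordinate class of coordinate $i$ is the set of edges of $G$ whose endpoints' labels differ in coordinate $i$ (only nonempty classes are considered). A subgraph is convex if it contains every shortest path of $G$ between any two of its vertices. -}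

module Defs where

open import Level using (0ℓ)
open import Data.Bool using (Bool; true; false)
import Data.Bool.Properties as Bool
open import Data.Fin using (Fin; zero; suc)
import Data.Fin.Properties as Fin
open import Data.List using (List; []; _∷_)
open import Data.List.Relation.Unary.All using (All)
open import Data.Nat using (ℕ; zero; suc; _+_; _^_; _≤_; z≤n; s≤s)
open import Data.Product using (Σ; ∃; _×_; _,_; proj₁; uncurry)
open import Data.Product.Function.NonDependent.Propositional using (_×-↔_)
open import Data.Vec using (Vec; []; _∷_; lookup)
open import Function using (_∘_)
open import Function.Bundles using (_↔_; Inverse; mk↔ₛ′)
open import Function.Properties.Inverse using (↔-sym; ↔-trans; ↔⇒↣)
open import Relation.Binary.Core using (Rel)
open import Relation.Binary.Definitions
  using (Decidable; DecidableEquality; Symmetric; Irreflexive)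
open import Relation.Binary.PropositionalEquality
  using (_≡_; _≢_; refl; sym; cong; subst)
open import Relation.Nullary using (Dec; yes; no; contradiction)
open import Relation.Nullary.Decidable using (map′; ¬?; _×-dec_; _→-dec_)
open import Relation.Unary using (Pred; Satisfiable; _≐_)
import Relation.Unary as U

least : {P : Pred ℕ 0ℓ} → U.Decidable P → ∀ k → P k →
        ∃ λ m → P m × (∀ j → P j → m ≤ j)
least P? zero p = 0 , p , λ _ _ → z≤n
least P? (suc k) p with P? 0
... | yes p₀ = 0 , p₀ , λ _ _ → z≤n
... | no ¬p₀ with least (P? ∘ suc) k p
...   | m , pm , min = suc m , pm ,
        λ { zero p₀ → contradiction p₀ ¬p₀ ; (suc j) q → s≤s (min j q) }

data Walk {V : Set} (_~_ : Rel V 0ℓ) : V → V → ℕ → Set where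
  []  : ∀ {v} → Walk _~_ v v 0
  _∷_ : ∀ {u v w n} → u ~ v → Walk _~_ v w n → Walk _~_ u w (suc n)

vertices : {V : Set} {_~_ : Rel V 0ℓ} {u w : V} {n : ℕ} → Walk _~_ u w n → List V
vertices {u = u} []      = u ∷ []
vertices {u = u} (_ ∷ p) = u ∷ vertices p

-- Finite, simple, undirected, connected graphs.
record Graph : Set₁ where
  infix 4 _~_ _~?_
  field
    V         : Set
    size      : ℕ
    finite    : V ↔ Fin size
    _~_       : Rel V 0ℓ
    _~?_      : Decidable _~_
    ~-sym     : Symmetric _~_
    ~-irrefl  : Irreflexive _≡_ _~_
    connected : ∀ u v → ∃ (Walk _~_ u v)

  _≟_ : DecidableEquality V
  _≟_ = Fin.inj⇒≟ (↔⇒↣ finite)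

  any? : {P : Pred V 0ℓ} → U.Decidable P → Dec (∃ P)
  any? {P} P? = map′
    (λ { (i , p) → from i , p })
    (λ { (v , p) → to v , subst P (sym (strictlyInverseʳ v)) p })
    (Fin.any? (P? ∘ from))
    where open Inverse finite

  walk? : ∀ u w → U.Decidable (Walk _~_ u w)
  walk? u w zero    = map′ (λ { refl → [] }) (λ { [] → refl }) (u ≟ w)
  walk? u w (suc n) = map′
    (λ { (_ , a , p) → a ∷ p }) (λ { (a ∷ p) → _ , a , p })
    (any? λ v → (u ~? v) ×-dec walk? v w n)

  distance : ∀ u v → ∃ λ m → Walk _~_ u v m × (∀ j → Walk _~_ u v j → m ≤ j)
  distance u v = uncurry (least (walk? u v)) (connected u v)

  d : V → V → ℕ
  d u v = proj₁ (distance u v)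

  -- An edge {u,v} is represented by either of its two orientations. φ, θ, cuts
  -- and coordinate classes do not change when an edge is reversed, so they (and
  -- the equivalence classes of φ and θ) are relations on, and sets of,
  -- unordered edges.
  record Edge : Set where
    eta-equality
    constructor edge
    field
      {end₁ end₂} : V
      adjacent    : end₁ ~ end₂

  φ : Rel Edge 0ℓ
  φ (edge {u} {v} _) (edge {x} {y} _) = d u x ≡ d v y × d u y ≡ d v x

  θ : Rel Edge 0ℓ
  θ (edge {u} {v} _) (edge {x} {y} _) = d u x + d v y ≢ d u y + d v x

  IsClass : Rel Edge 0ℓ → Pred (Pred Edge 0ℓ) 0ℓ
  IsClass R C = ∃ λ e → C ≐ R e

  Bipartite : Set
  Bipartite = ∃ λ (colour : V → Bool) → ∀ {u v} → u ~ v → colour u ≢ colour v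

  -- Convexity of the subgraph induced on S: since it is induced, it contains a
  -- path as soon as it contains the vertices of that path. A walk of length
  -- d u v is the same thing as a shortest path from u to v.
  Convex : Pred (Pred V 0ℓ) 0ℓ
  Convex S = ∀ {u v} → S u → S v → (p : Walk _~_ u v (d u v)) → All S (vertices p)

  cut : (V → Bool) → Pred Edge 0ℓ
  cut side (edge {u} {v} _) = side u ≢ side v

  IsConvexCut : Pred (Pred Edge 0ℓ) 0ℓ
  IsConvexCut C = ∃ λ (side : V → Bool) →
    C ≐ cut side × Convex (λ v → side v ≡ true) × Convex (λ v → side v ≡ false)

open Graph using (V; d; Edge; edge)

Isometric : (G H : Graph) → (V G → V H) → Set
Isometric G H f = ∀ u v → d H (f u) (f v) ≡ d G u v

-- Bool plays the role of the underlying set of ℤ₂.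
Label : ℕ → Set
Label = Vec Bool

infix 4 _~Q_

_~Q_ : ∀ {k} → Rel (Label k) 0ℓ
x ~Q y = ∃ λ i → lookup x i ≢ lookup y i × (∀ j → lookup x j ≢ lookup y j → j ≡ i)

label-finite : ∀ k → Label k ↔ Fin (2 ^ k)
label-finite zero    = mk↔ₛ′ (λ _ → zero) (λ _ → []) (λ { zero → refl }) (λ { [] → refl })
label-finite (suc k) =
  ↔-trans (mk↔ₛ′ (λ { (b ∷ x) → b , x }) (λ { (b , x) → b ∷ x })
                 (λ { (_ , _) → refl }) (λ { (_ ∷ _) → refl }))
  (↔-trans (↔-sym Fin.2↔Bool ×-↔ label-finite k) (↔-sym Fin.*↔×))

_~Q?_ : ∀ {k} → Decidable (_~Q_ {k})
x ~Q? y = Fin.any? λ i → differ? i ×-dec Fin.all? λ j → differ? j →-dec (j Fin.≟ i)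
  where differ? = λ i → ¬? (lookup x i Bool.≟ lookup y i)

~Q-cons : ∀ {k} b {x y : Label k} → x ~Q y → (b ∷ x) ~Q (b ∷ y)
~Q-cons b (i , p , u) = suc i , p ,
  λ { zero q → contradiction refl q ; (suc j) q → cong suc (u j q) }

~Q-flip : ∀ {k} {b c} → b ≢ c → (x : Label k) → (b ∷ x) ~Q (c ∷ x)
~Q-flip b≢c x = zero , b≢c , λ { zero _ → refl ; (suc j) q → contradiction refl q }

walk-cons : ∀ {k n} b {x y : Label k} → Walk _~Q_ x y n → Walk _~Q_ (b ∷ x) (b ∷ y) n
walk-cons b []      = []
walk-cons b (a ∷ p) = ~Q-cons b a ∷ walk-cons b p

Q-connected : ∀ {k} (x y : Label k) → ∃ (Walk _~Q_ x y)
Q-connected []      []      = 0 , []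
Q-connected (b ∷ x) (c ∷ y) with b Bool.≟ c | Q-connected x y
... | yes refl | n , p = n , walk-cons b p
... | no b≢c   | n , p = suc n , ~Q-flip b≢c x ∷ walk-cons c p

Q : ℕ → Graph
Q k = record
  { V         = Label k
  ; size      = 2 ^ k
  ; finite    = label-finite k
  ; _~_       = _~Q_
  ; _~?_      = _~Q?_
  ; ~-sym     = λ { (i , p , u) → i , p ∘ sym , λ j q → u j (q ∘ sym) }
  ; ~-irrefl  = λ { refl (_ , p , _) → p refl }
  ; connected = Q-connected
  }

IsPartialCube : Graph → Set
IsPartialCube G = ∃ λ k → Σ (V G → Label k) (Isometric G (Q k))

coordinateClass : ∀ (G : Graph) {k} → (V G → Label k) → Fin k → Pred (Edge G) 0ℓ
coordinateClass G ι i (edge {u} {v} _) = lookup (ι u) i ≢ lookup (ι v) i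

IsCoordinateClass : ∀ (G : Graph) {k} → (V G → Label k) → Pred (Pred (Edge G) 0ℓ) 0ℓ
IsCoordinateClass G ι C = ∃ λ i → Satisfiable C × C ≐ coordinateClass G ι i

{-# OPTIONS --safe #-}
-- (a) If the labels of u and v differ exactly in coordinate i, then d u z and
-- d v z differ by one, the larger distance belonging to the endpoint that
-- disagrees with z at i. Applied around the square u, v, x, y this shows that two
-- edges are related by φ, and likewise by θ, iff they flip the same coordinate.
--
-- (b) Label a vertex by the sides it lies on, with one cut per φ-class. An edge
-- lies in exactly one cut, so its endpoints get adjacent labels. The first edge
-- u v of a shortest path from u to w moves towards w in its coordinate i: else u
-- and w would lie on the same side of cut i and v on the other one, against
-- convexity. Hence Hamming distances of labels are distances in G.
module Submission where

open import Defs
open import Level using (0ℓ)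
open import Data.Product using (_×_)
open import Function.Bundles using (_⇔_)
open import Relation.Binary.Structures using (IsEquivalence)
open import Relation.Unary using (Pred)
open Graph using (V; Edge; φ; θ; IsClass; Bipartite; IsConvexCut)

open import Data.Bool using (Bool; true; false; if_then_else_; _xor_)
open import Data.Bool.Properties using (¬-not; xor-comm) renaming (_≟_ to _≟ᵇ_)
open import Data.Fin using (Fin; zero; suc)
import Data.Fin.Properties as Fin
open import Data.List as List using (List; _∷_; allFin; cartesianProduct; deduplicate; mapMaybe)
open import Data.List.Membership.Propositional using (_∈_; lose)
open import Data.List.Membership.Propositional.Properties
  using (∈-lookup; ∈-allFin; ∈-cartesianProduct⁺; ∈-map⁺)
open import Data.List.Relation.Unary.All using (All; _∷_)
import Data.List.Relation.Unary.All as All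
open import Data.List.Relation.Unary.AllPairs using (AllPairs; _∷_)
open import Data.List.Relation.Unary.Any using (Any; index)
import Data.List.Relation.Unary.Any.Properties as Any
open import Data.List.Relation.Unary.Unique.DecSetoid.Properties using (deduplicate-!)
import Data.Maybe as Maybe
import Data.Maybe.Relation.Unary.Any as MAny
open import Data.Nat using (ℕ; suc; _+_; _≤_; z≤n; s≤s; s≤s⁻¹)
import Data.Nat as ℕ
open import Data.Nat.Properties
  using (≤-antisym; ≤-reflexive; ≤-trans; m≤n⇒m≤1+n; n≤1+n; suc-injective; m≢1+n+m
        ; +-comm; +-suc)
open import Data.Product using (_,_; proj₁; proj₂; map; swap)
open import Data.Vec using ([]; _∷_; lookup; tabulate)
open import Data.Vec.Properties using (lookup∘tabulate)
open import Data.Vec.Relation.Binary.Pointwise.Extensional using (ext; extensional⇒inductive)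
open import Data.Vec.Relation.Binary.Pointwise.Inductive using (Pointwise-≡⇒≡)
open import Function using (_∘_; id)
open import Function.Bundles using (Inverse; Equivalence; mk⇔)
open import Function.Properties.Equivalence using (⇔-isEquivalence)
open import Relation.Binary.Bundles using (DecSetoid)
open import Relation.Binary.Core using (Rel)
open import Relation.Binary.Definitions using (Decidable; Symmetric)
open import Relation.Binary.PropositionalEquality
  using (_≡_; _≢_; refl; sym; trans; cong; cong₂; subst; subst₂; ≢-sym)
open import Relation.Nullary using (¬_; yes; no; contradiction)
open import Relation.Nullary.Decidable using (_×-dec_; decidable-stable; dec⇒maybe)
open Graph using (edge)
open Equivalence using (to; from)

-- Preliminaries on equivalences, Booleans, lists and walks.

⇔-sym : {A B : Set} → A ⇔ B → B ⇔ A
⇔-sym = IsEquivalence.sym ⇔-isEquivalence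

⇔-trans : {A B C : Set} → A ⇔ B → B ⇔ C → A ⇔ C
⇔-trans = IsEquivalence.trans ⇔-isEquivalence

≢∧≢⇒≡ : ∀ {a b c : Bool} → a ≢ b → b ≢ c → a ≡ c
≢∧≢⇒≡ a≢b b≢c = trans (¬-not a≢b) (sym (¬-not (≢-sym b≢c)))

-- Serves deduplicated lists, whose entries are pairwise unrelated: distinct positions then stand
-- for distinct classes.
AllPairs-¬⇒lookup-injective : {A : Set} {R : Rel A 0ℓ} → Symmetric R →
  ∀ {xs : List A} → AllPairs (λ x y → ¬ R x y) xs →
  ∀ i j → R (List.lookup xs i) (List.lookup xs j) → i ≡ j
AllPairs-¬⇒lookup-injective R-sym (_ ∷ _) zero zero _ = refl
AllPairs-¬⇒lookup-injective R-sym (¬r ∷ _) zero (suc j) r =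
  contradiction r (All.lookup ¬r (∈-lookup j))
AllPairs-¬⇒lookup-injective R-sym (¬r ∷ _) (suc i) zero r =
  contradiction (R-sym r) (All.lookup ¬r (∈-lookup i))
AllPairs-¬⇒lookup-injective R-sym (_ ∷ ps) (suc i) (suc j) r =
  cong suc (AllPairs-¬⇒lookup-injective R-sym ps i j r)

All-start : {A : Set} {_~_ : Rel A 0ℓ} {S : Pred A 0ℓ} {u w : A} {n : ℕ} →
  (p : Walk _~_ u w n) → All S (vertices p) → S u
All-start []      (s ∷ _) = s
All-start (_ ∷ _) (s ∷ _) = s

-- Distance as the least length of a walk.

module _ (G : Graph) where
  open Graph G using (_~_; d; distance; ~-irrefl)

  geodesic : ∀ u v → Walk _~_ u v (d u v)
  geodesic u v = proj₁ (proj₂ (distance u v))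

  d-≤ : ∀ {u v n} → Walk _~_ u v n → d u v ≤ n
  d-≤ {u} {v} p = proj₂ (proj₂ (distance u v)) _ p

  d-unique : ∀ {u v m} → Walk _~_ u v m → (∀ {n} → Walk _~_ u v n → m ≤ n) → d u v ≡ m
  d-unique p least-p = ≤-antisym (d-≤ p) (least-p (geodesic _ _))

  d-adjacent : ∀ {u v} → u ~ v → d u v ≡ 1
  d-adjacent a = d-unique (a ∷ []) λ where
    []      → contradiction a (~-irrefl refl)
    (_ ∷ _) → s≤s z≤n

-- Hamming distance and the metric of the hypercube.

hamming : ∀ {k} → Label k → Label k → ℕ
hamming []      []      = 0
hamming (a ∷ x) (b ∷ y) = (if a xor b then 1 else 0) + hamming x y

hamming-self : ∀ {k} (x : Label k) → hamming x x ≡ 0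
hamming-self []          = refl
hamming-self (true  ∷ x) = hamming-self x
hamming-self (false ∷ x) = hamming-self x

hamming-comm : ∀ {k} (x y : Label k) → hamming x y ≡ hamming y x
hamming-comm []      []      = refl
hamming-comm (a ∷ x) (b ∷ y) =
  cong₂ (λ c n → (if c then 1 else 0) + n) (xor-comm a b) (hamming-comm x y)

-- This is `_~Q_` with the flipped coordinate exposed as a parameter, so that edges can be compared
-- by it.
DifferOnlyAt : ∀ {k} → Fin k → Rel (Label k) 0ℓ
DifferOnlyAt i x y = lookup x i ≢ lookup y i × (∀ j → lookup x j ≢ lookup y j → j ≡ i)

DifferOnlyAt-sym : ∀ {k} {i : Fin k} {x y} → DifferOnlyAt i x y → DifferOnlyAt i y x
DifferOnlyAt-sym (p , only) = ≢-sym p , λ j → only j ∘ ≢-sym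

agree-elsewhere : ∀ {k} {i j : Fin k} {x y} →
  DifferOnlyAt i x y → j ≢ i → lookup x j ≡ lookup y j
agree-elsewhere (_ , only) j≢i = decidable-stable (_ ≟ᵇ _) (j≢i ∘ only _)

-- Passing from `x` to `y` repairs the disagreement with `z` at `i` and touches no other coordinate.
hamming-step : ∀ {k} {i : Fin k} (x y z : Label k) → DifferOnlyAt i x y →
  lookup y i ≡ lookup z i → hamming x z ≡ suc (hamming y z)
hamming-step {i = zero} (a ∷ x) (b ∷ y) (.b ∷ z) δ refl
  -- The only difference is at the head, so the tails are equal.
  with Pointwise-≡⇒≡ (extensional⇒inductive {xs = x} {ys = y}
         (ext λ j → agree-elsewhere {j = suc j} {x = a ∷ x} {y = b ∷ y} δ (λ { () })))
hamming-step {i = zero} (true  ∷ x) (true  ∷ x) (_ ∷ z) (a≢b , _) refl | refl = contradiction refl a≢b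
hamming-step {i = zero} (true  ∷ x) (false ∷ x) (_ ∷ z) _ refl | refl = refl
hamming-step {i = zero} (false ∷ x) (true  ∷ x) (_ ∷ z) _ refl | refl = refl
hamming-step {i = zero} (false ∷ x) (false ∷ x) (_ ∷ z) (a≢b , _) refl | refl = contradiction refl a≢b
hamming-step {i = suc i} (a ∷ x) (b ∷ y) (c ∷ z) δ@(p , only) y≡z
  with refl ← agree-elsewhere {j = zero} {x = a ∷ x} {y = b ∷ y} δ (λ ()) =
  trans (cong (_ +_) (hamming-step x y z (p , λ j → Fin.suc-injective ∘ only (suc j)) y≡z))
        (+-suc (if a xor c then 1 else 0) _)

hamming-walk : ∀ {k} (x y : Label k) → Walk _~Q_ x y (hamming x y)
hamming-walk []          []          = []
hamming-walk (true  ∷ x) (true  ∷ y) = walk-cons true (hamming-walk x y)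
hamming-walk (true  ∷ x) (false ∷ y) = ~Q-flip (λ ()) x ∷ walk-cons false (hamming-walk x y)
hamming-walk (false ∷ x) (true  ∷ y) = ~Q-flip (λ ()) x ∷ walk-cons true (hamming-walk x y)
hamming-walk (false ∷ x) (false ∷ y) = walk-cons false (hamming-walk x y)

-- The first edge changes the Hamming distance to the end `z` by exactly one: it drops if `y` agrees
-- with `z` at the flipped coordinate; otherwise `x` agrees there and it grows.
hamming-≤ : ∀ {k n} {x y : Label k} → Walk _~Q_ x y n → hamming x y ≤ n
hamming-≤ {x = x} [] = ≤-reflexive (hamming-self x)
hamming-≤ {x = x} {z} (_∷_ {v = y} (i , δ) p) with lookup y i ≟ᵇ lookup z i
... | yes y≡z = ≤-trans (≤-reflexive (hamming-step x y z δ y≡z)) (s≤s (hamming-≤ p))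
... | no  y≢z = m≤n⇒m≤1+n (≤-trans (n≤1+n _) (≤-trans (≤-reflexive (sym
        (hamming-step y x z (DifferOnlyAt-sym {x = x} {y} δ) (≢∧≢⇒≡ (proj₁ δ) y≢z))))
        (hamming-≤ p)))

d-Q : ∀ {k} (x y : Label k) → Graph.d (Q k) x y ≡ hamming x y
d-Q {k} x y = d-unique (Q k) (hamming-walk x y) hamming-≤

-- Edges of an isometrically labelled graph, compared by the coordinate they flip.

module IsometricLabelling (G : Graph) {k} (ι : V G → Label k) (iso : Isometric G (Q k) ι) where
  open Graph G using (_~_; d)

  d-hamming : ∀ u v → d u v ≡ hamming (ι u) (ι v)
  d-hamming u v = trans (sym (iso u v)) (d-Q (ι u) (ι v))

  d-sym : ∀ u v → d u v ≡ d v u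
  d-sym u v = trans (d-hamming u v) (trans (hamming-comm (ι u) (ι v)) (sym (d-hamming v u)))

  -- Isometry keeps the endpoints at distance one, and a walk of length one is a single edge.
  ι-adjacent : ∀ {u v} → u ~ v → ι u ~Q ι v
  ι-adjacent {u} {v} a
    with b ∷ [] ← subst (Walk _~Q_ (ι u) (ι v)) (trans (iso u v) (d-adjacent G a))
                        (geodesic (Q k) (ι u) (ι v)) = b

  bit : V G → Fin k → Bool
  bit u = lookup (ι u)

  Flips : Fin k → Rel (V G) 0ℓ
  Flips i u v = DifferOnlyAt i (ι u) (ι v)

  Flips-sym : ∀ {i u v} → Flips i u v → Flips i v u
  Flips-sym {i} {u} {v} = DifferOnlyAt-sym {i = i} {ι u} {ι v}

  -- `φ` and `θ` on bare vertices: reversing an edge is a permutation of arguments, with no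
  -- adjacency proof to carry along.
  Φ Θ : V G → V G → V G → V G → Set
  Φ u v x y = d u x ≡ d v y × d u y ≡ d v x
  Θ u v x y = d u x + d v y ≢ d u y + d v x

  step : ∀ {i u v} → Flips i u v → ∀ z → bit v i ≡ bit z i → d u z ≡ suc (d v z)
  step {u = u} {v} δ z e =
    trans (d-hamming u z)
      (trans (hamming-step (ι u) (ι v) (ι z) δ e) (cong suc (sym (d-hamming v z))))

  step′ : ∀ {i u v} → Flips i u v → ∀ z → bit v i ≡ bit z i → d z u ≡ suc (d z v)
  step′ {u = u} {v} δ z e = trans (d-sym z u) (trans (step δ z e) (cong suc (d-sym v z)))

  Φ-swapˡ : ∀ {u v x y} → Φ v u x y → Φ u v x y
  Φ-swapˡ (p , q) = sym q , sym p

  Θ-swapˡ : ∀ {u v x y} → Θ v u x y → Θ u v x y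
  Θ-swapˡ {u} {v} {x} {y} ≠ e =
    ≠ (trans (+-comm (d v x) (d u y)) (trans (sym e) (+-comm (d u x) (d v y))))

  -- Put n = `d u x`. Flipping one end at `i` gives n + 1 for `d v x` and `d u y`; flipping both
  -- restores agreement, so `d v y` is n. The sums are 2n and 2n + 2.
  same-aligned : ∀ {i u v x y} → Flips i u v → Flips i x y → bit u i ≡ bit x i →
    Φ u v x y × Θ u v x y
  same-aligned {i} {u} {v} {x} {y} δ ε u≡x = (ux≡vy , uy≡vx) , ux+vy≢uy+vx
    where
    v≡y : bit v i ≡ bit y i
    v≡y = ≢∧≢⇒≡ (≢-sym (proj₁ δ)) (subst (_≢ bit y i) (sym u≡x) (proj₁ ε))
    vx : d v x ≡ suc (d u x)
    vx = step (Flips-sym δ) x u≡x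
    uy : d u y ≡ suc (d u x)
    uy = step′ (Flips-sym ε) u (sym u≡x)
    ux≡vy : d u x ≡ d v y
    ux≡vy = suc-injective (trans (sym vx) (step′ ε v (sym v≡y)))
    uy≡vx : d u y ≡ d v x
    uy≡vx = trans uy (sym vx)
    ux+vy≢uy+vx : d u x + d v y ≢ d u y + d v x
    ux+vy≢uy+vx e rewrite sym ux≡vy | uy | vx | +-suc (d u x) (d u x) = m≢1+n+m _ {1} e

  -- If `u` and `x` disagree at `i`, reversing the second edge aligns them; it swaps the equations
  -- of `Φ` and the sums of `Θ`.
  same : ∀ {i u v x y} → Flips i u v → Flips i x y → Φ u v x y × Θ u v x y
  same {i} {u} {v} {x} {y} δ ε with bit u i ≟ᵇ bit x i
  ... | yes u≡x = same-aligned δ ε u≡x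
  ... | no  u≢x = map swap ≢-sym
                    (same-aligned δ (Flips-sym ε) (≢∧≢⇒≡ u≢x (proj₁ ε)))

  -- Flips of distinct coordinates add up: with n = `d u x`, both `d v x` and `d u y` are n + 1 and
  -- `d v y` is n + 2. The first equation of `Φ` fails, and both sums are 2n + 2.
  different-aligned : ∀ {i j u v x y} → i ≢ j → Flips i u v → Flips j x y →
    bit u i ≡ bit x i → bit u j ≡ bit x j → ¬ Φ u v x y × ¬ Θ u v x y
  different-aligned {i} {j} {u} {v} {x} {y} i≢j δ ε u≡x u≡ʲx = ¬Φ , ¬Θ
    where
    x≡y : bit x i ≡ bit y i
    x≡y = agree-elsewhere {x = ι x} {ι y} ε i≢j
    vx : d v x ≡ suc (d u x)
    vx = step (Flips-sym δ) x u≡x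
    vy : d v y ≡ suc (d u y)
    vy = step (Flips-sym δ) y (trans u≡x x≡y)
    uy : d u y ≡ suc (d u x)
    uy = step′ (Flips-sym ε) u (sym u≡ʲx)
    ¬Φ : ¬ Φ u v x y
    ¬Φ (p , _) rewrite vy | uy = m≢1+n+m _ {1} p
    ¬Θ : ¬ Θ u v x y
    ¬Θ ≠ rewrite vx | vy | uy = ≠ (+-suc (d u x) (suc (d u x)))

  -- A disagreement of `u` and `x` at `i` is removed by reversing the first edge, one at `j` by
  -- reversing the second; `Φ` and `Θ` survive both reversals.
  different : ∀ {i j u v x y} → i ≢ j → Flips i u v → Flips j x y →
    ¬ Φ u v x y × ¬ Θ u v x y
  different {i} {j} {u} {v} {x} {y} i≢j δ ε with bit u i ≟ᵇ bit x i | bit u j ≟ᵇ bit x j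
  ... | yes u≡x | yes u≡ʲx = different-aligned i≢j δ ε u≡x u≡ʲx
  ... | yes u≡x | no  u≢ʲx = map (_∘ swap) (_∘ ≢-sym)
          (different-aligned i≢j δ (Flips-sym ε)
            (trans u≡x (agree-elsewhere {x = ι x} {ι y} ε i≢j)) (≢∧≢⇒≡ u≢ʲx (proj₁ ε)))
  ... | no  u≢x | yes u≡ʲx = map (_∘ Φ-swapˡ) (_∘ Θ-swapˡ)
          (different-aligned i≢j (Flips-sym δ) ε
            (≢∧≢⇒≡ (≢-sym (proj₁ δ)) u≢x)
            (trans (sym (agree-elsewhere {x = ι u} {ι v} δ (≢-sym i≢j))) u≡ʲx))
  ... | no  u≢x | no  u≢ʲx = map (_∘ Φ-swapˡ ∘ swap) (_∘ Θ-swapˡ ∘ ≢-sym)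
          (different-aligned i≢j (Flips-sym δ) (Flips-sym ε)
            (trans (≢∧≢⇒≡ (≢-sym (proj₁ δ)) u≢x) (agree-elsewhere {x = ι x} {ι y} ε i≢j))
            (trans (sym (agree-elsewhere {x = ι u} {ι v} δ (≢-sym i≢j)))
                   (≢∧≢⇒≡ u≢ʲx (proj₁ ε))))

  coordinate : Edge G → Fin k
  coordinate (edge a) = proj₁ (ι-adjacent a)

  flips : ∀ {u v} (a : u ~ v) → Flips (coordinate (edge a)) u v
  flips a = proj₂ (ι-adjacent a)

  φ⇔coordinate : ∀ e f → φ G e f ⇔ coordinate e ≡ coordinate f
  φ⇔coordinate (edge a) (edge {z} {w} b) = mk⇔
    (λ p → decidable-stable (_ Fin.≟ _) λ i≢j → proj₁ (different i≢j (flips a) (flips b)) p)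
    (λ e → proj₁ (same (flips a) (subst (λ i → Flips i z w) (sym e) (flips b))))

  θ⇔coordinate : ∀ e f → θ G e f ⇔ coordinate e ≡ coordinate f
  θ⇔coordinate (edge a) (edge {z} {w} b) = mk⇔
    (λ p → decidable-stable (_ Fin.≟ _) λ i≢j → proj₂ (different i≢j (flips a) (flips b)) p)
    (λ e → proj₂ (same (flips a) (subst (λ i → Flips i z w) (sym e) (flips b))))

  φ⇔θ : ∀ e f → φ G e f ⇔ θ G e f
  φ⇔θ e f = ⇔-trans (φ⇔coordinate e f) (⇔-sym (θ⇔coordinate e f))

  kernel-isEquivalence : ∀ {R : Rel (Edge G) 0ℓ} →
    (∀ e f → R e f ⇔ coordinate e ≡ coordinate f) → IsEquivalence R
  kernel-isEquivalence R⇔ = record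
    { refl  = λ {e} → from (R⇔ e e) refl
    ; sym   = λ {e} {f} r → from (R⇔ f e) (sym (to (R⇔ e f) r))
    ; trans = λ {e} {f} {g} r s → from (R⇔ e g) (trans (to (R⇔ e f) r) (to (R⇔ f g) s))
    }

  class⇔coordinate : ∀ i e → coordinateClass G ι i e ⇔ i ≡ coordinate e
  class⇔coordinate i (edge a) = mk⇔
    (λ p → proj₂ (flips a) i p)
    (λ { refl → proj₁ (flips a) })

  -- The class of `e` belongs to the coordinate that `e` flips. Conversely, nonemptiness of a
  -- coordinate class supplies the representative `e`.
  φ-class⇔coordinateClass : ∀ C → IsClass G (φ G) C ⇔ IsCoordinateClass G ι C
  φ-class⇔coordinateClass C = mk⇔
    (λ { (e , C⊆φ , φ⊆C) → coordinate e , (e , φ⊆C (from (φ⇔coordinate e e) refl)) ,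
         (λ {f} c → from (class⇔coordinate _ f) (to (φ⇔coordinate e f) (C⊆φ c))) ,
         (λ {f} c → φ⊆C (from (φ⇔coordinate e f) (to (class⇔coordinate _ f) c))) })
    (λ { (i , (e , Ce) , C⊆ , ⊆C) → let i≡e = to (class⇔coordinate i e) (C⊆ Ce) in e ,
         (λ {f} c → from (φ⇔coordinate e f) (trans (sym i≡e) (to (class⇔coordinate i f) (C⊆ c)))) ,
         (λ {f} p → ⊆C (from (class⇔coordinate i f) (trans i≡e (to (φ⇔coordinate e f) p)))) })

-- Enumeration of the edges.

module _ (G : Graph) where
  open Graph G using (_~_; _~?_; finite)
  open Inverse finite using (strictlyInverseʳ) renaming (from to vertex; to to number)

  φ? : Decidable (φ G)
  φ? (edge _) (edge _) = (_ ℕ.≟ _) ×-dec (_ ℕ.≟ _)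

  -- Both orientations of every edge occur, but only one adjacency proof for each.
  edges : List (Edge G)
  edges = mapMaybe (λ (u , v) → Maybe.map (λ a → edge {end₁ = u} {v} a) (dec⇒maybe (u ~? v)))
                   (cartesianProduct vertexList vertexList)
    where vertexList = List.map vertex (allFin _)

  -- Adjacency proofs may differ from the one that `_~?_` returns, so `edge a` itself can be absent;
  -- hence `P` is required for every proof `b`.
  edges-complete : ∀ {u v} (P : Pred (Edge G) 0ℓ) →
    (∀ (b : u ~ v) → P (edge b)) → u ~ v → Any P edges
  edges-complete {u} {v} P Puv a = Any.mapMaybe⁺ _ _
    (lose (∈-map⁺ _ (∈-cartesianProduct⁺ (∈-vertices u) (∈-vertices v))) just-edge)
    where
    ∈-vertices : ∀ u → u ∈ List.map vertex (allFin _)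
    ∈-vertices u = subst (_∈ _) (strictlyInverseʳ u) (∈-map⁺ vertex (∈-allFin (number u)))
    just-edge : MAny.Any P (Maybe.map edge (dec⇒maybe (u ~? v)))
    just-edge with u ~? v
    ... | yes b = MAny.just (Puv b)
    ... | no ¬a = contradiction a ¬a

-- The labelling given by convex cuts.

module ConvexCuts (G : Graph) (φ-isEquivalence : IsEquivalence (φ G))
                  (convexCut : ∀ e → IsConvexCut G (φ G e)) where
  open Graph G using (_~_; d; Convex)
  module φ = IsEquivalence φ-isEquivalence

  φ-decSetoid : DecSetoid 0ℓ 0ℓ
  φ-decSetoid = record
    { isDecEquivalence = record { isEquivalence = φ-isEquivalence ; _≟_ = φ? G } }

  representatives : List (Edge G)
  representatives = deduplicate (φ? G) (edges G)

  representative : Fin (List.length representatives) → Edge G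
  representative = List.lookup representatives

  represented : ∀ {u v} (a : u ~ v) → Any (λ e → φ G e (edge a)) representatives
  represented a = Any.deduplicate⁺ (φ? G) (λ {e} {f} p q → φ.trans {f} {e} {edge a} p q)
    -- `φ` sees only endpoints, so reflexivity at `edge a` also relates `edge b` to it.
    (edges-complete G (λ e → φ G e (edge a)) (λ b → φ.refl {edge a}) a)

  representative-injective : ∀ i j → φ G (representative i) (representative j) → i ≡ j
  representative-injective =
    AllPairs-¬⇒lookup-injective (λ {e} {f} → φ.sym {e} {f}) (deduplicate-! φ-decSetoid (edges G))

  side : Edge G → V G → Bool
  side e = proj₁ (convexCut e)

  φ⇒separated : ∀ e {u v} (a : u ~ v) → φ G e (edge a) → side e u ≢ side e v
  φ⇒separated e a = proj₁ (proj₁ (proj₂ (convexCut e))) {edge a}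

  separated⇒φ : ∀ e {u v} (a : u ~ v) → side e u ≢ side e v → φ G e (edge a)
  separated⇒φ e a = proj₂ (proj₁ (proj₂ (convexCut e))) {edge a}

  side-convex : ∀ e b → Convex (λ v → side e v ≡ b)
  side-convex e true  = proj₁ (proj₂ (proj₂ (convexCut e)))
  side-convex e false = proj₂ (proj₂ (proj₂ (convexCut e)))

  label : V G → Label (List.length representatives)
  label u = tabulate λ i → side (representative i) u

  lookup-label : ∀ u i → lookup (label u) i ≡ side (representative i) u
  lookup-label u = lookup∘tabulate _

  -- A cut separates `u` from `v` only if its class contains this edge, and each class has exactly
  -- one representative.
  label-adjacent : ∀ {u v} → u ~ v → label u ~Q label v
  label-adjacent {u} {v} a = i ,
    subst₂ _≢_ (sym (lookup-label u i)) (sym (lookup-label v i))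
      (φ⇒separated (representative i) a i-represents) ,
    λ j p → representative-injective j i
      (φ.trans {representative j} {edge a} {representative i}
        (separated⇒φ (representative j) a (subst₂ _≢_ (lookup-label u j) (lookup-label v j) p))
        (φ.sym {representative i} {edge a} i-represents))
    where
    i = index (represented a)
    i-represents : φ G (representative i) (edge a)
    i-represents = Any.lookup-index (represented a)

  first-edge-same-side : ∀ e {u v w n} (a : u ~ v) (p : Walk _~_ v w n) → suc n ≡ d u w →
    side e u ≡ side e w → side e v ≡ side e u
  first-edge-same-side e {u} {v} {w} a p eq u≡w = All-start p (All.tail (on-walk (a ∷ p) eq))
    where
    -- `Convex` wants the length to be literally `d u w`; with a variable length the equation can be
    -- matched by `refl`.
    on-walk : ∀ {n} (q : Walk _~_ u w n) → n ≡ d u w → All (λ x → side e x ≡ side e u) (vertices q)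
    on-walk q refl = side-convex e (side e u) refl (sym u≡w) q

  hamming-geodesic : ∀ {u w n} (p : Walk _~_ u w n) → n ≡ d u w → hamming (label u) (label w) ≡ n
  hamming-geodesic {u} [] _ = hamming-self (label u)
  hamming-geodesic {u} {w} (_∷_ {v = v} a p) eq =
    trans (hamming-step (label u) (label v) (label w) δ v≡w) (cong suc (hamming-geodesic p tail))
    where
    i = proj₁ (label-adjacent a)
    δ = proj₂ (label-adjacent a)
    -- The rest is again shortest: prefixing `a` to a geodesic from `v` shows that `d u w` is at
    -- most 1 + `d v w`.
    tail : _ ≡ d v w
    tail = ≤-antisym (s≤s⁻¹ (subst (_≤ suc (d v w)) (sym eq) (d-≤ G (a ∷ geodesic G v w)))) (d-≤ G p)
    -- Otherwise `u`, having the other bit, would agree with `w`, and convexity would put `v` on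
    -- their side, although `a` crosses cut `i`.
    v≡w : lookup (label v) i ≡ lookup (label w) i
    v≡w = decidable-stable (_ ≟ᵇ _) λ v≢w → proj₁ δ (subst₂ _≡_
      (sym (lookup-label u i)) (sym (lookup-label v i))
      (sym (first-edge-same-side (representative i) a p eq
        (subst₂ _≡_ (lookup-label u i) (lookup-label w i) (≢∧≢⇒≡ (proj₁ δ) v≢w)))))

  isPartialCube : IsPartialCube G
  isPartialCube = _ , label , λ u v →
    trans (d-Q (label u) (label v)) (hamming-geodesic (geodesic G u v) refl)


theorem2p13 : (G : Graph) →
    (IsPartialCube G →
    (∀ e f → φ G e f ⇔ θ G e f) ×
    IsEquivalence (φ G) ×
    (∀ k (ι : V G → Label k) → Isometric G (Q k) ι →
    ∀ (C : Pred (Edge G) 0ℓ) → IsClass G (φ G) C ⇔ IsCoordinateClass G ι C)) ×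
    (Bipartite G →
    IsEquivalence (φ G) →
    (∀ (C : Pred (Edge G) 0ℓ) → IsClass G (φ G) C → IsConvexCut G C) →
    IsPartialCube G ×
    IsEquivalence (θ G) ×
    (∀ (C : Pred (Edge G) 0ℓ) → IsClass G (φ G) C ⇔ IsClass G (θ G) C))
theorem2p13 G = partA , partB
  where
  partA : _
  partA (k , ι , iso) = φ⇔θ , kernel-isEquivalence φ⇔coordinate ,
    -- The claim on classes concerns every isometric labelling, so the analysis is instantiated
    -- afresh for each.
    λ k ι iso → IsometricLabelling.φ-class⇔coordinateClass G ι iso
    where open IsometricLabelling G ι iso
  partB : _
  partB _ φ-isEquivalence classes-convex = isPartialCube , kernel-isEquivalence θ⇔coordinate ,
    λ C → mk⇔
      (λ (e , C⊆ , ⊆C) → e , (λ {f} c → to (φ⇔θ e f) (C⊆ c)) , (λ {f} p → ⊆C (from (φ⇔θ e f) p)))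
      (λ (e , C⊆ , ⊆C) → e , (λ {f} c → from (φ⇔θ e f) (C⊆ c)) , (λ {f} p → ⊆C (to (φ⇔θ e f) p)))
    where
    open ConvexCuts G φ-isEquivalence (λ e → classes-convex (φ G e) (e , id , id))
    -- The embedding just built is fed back into the analysis of isometric labellings, which
    -- identifies `φ` with `θ`.
    open IsometricLabelling G label (proj₂ (proj₂ isPartialCube))
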